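{- Let $D$ be a digraph on $\{1,\dots,n\}$. Then $$\sup\{\operatorname{per}(f^\sigma): q\ge2,\ f\in F[D,q],\ \sigma\text{ a complete schedule}\}=n-T(D).$$
   Context: A digraph $D=(V,E)$ has $V=\{1,\dots,n\}$, $E\subseteq V^2$ (loops allowed). $T(D)$ is the number of trivial strong components of $D$, i.e. strong components consisting of a single vertex without a loop (equivalently, vertices lying on no cycle). With $[q]=\{0,\dots,q-1\}$, for $f:[q]^n\to[q]^n$, $\mathrm{IG}(f)$ is the digraph on $V$ with $(u,v)$ an arc iff $f_v$ depends essentially on $x_u$; $F[D,q]=\{f:\mathrm{IG}(f)=D\}$. A schedule is a sequence $\sigma=(\sigma_1,\dots,\sigma_t)$ of subsets of $V$; for $S\subseteq V$, $f^{(S)}_v(x)=f_v(x)$ if $v\in S$ and $x_v$ otherwise; $f^\sigma=f^{(\sigma_t)}\circ\dots\circ f^{(\sigma_1)}$. $\sigma$ is complete if $\bigcup_i\sigma_i=V$. For $g:[q]^n\to[q]^n$, a point $x$ is periodic if $g^k(x)=x$ for some $k\ge1$, and $\operatorname{per}(g)=\log_q$ of the number of periodic points of $g$. -}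

module Defs where

open import Data.Nat using (ℕ; zero; suc; _≤_; _<_; _^_; _*_; _∸_)
open import Data.Bool using (Bool; true; false; if_then_else_)
open import Data.Fin using (Fin)
open import Data.Vec using (Vec; lookup; tabulate; _[_]≔_)
open import Data.List using (List; []; _∷_; length)
open import Data.List.Membership.Propositional using (_∈_)
open import Data.List.Relation.Unary.Unique.Propositional using (Unique)
open import Data.Product using (Σ; ∃; _×_; _,_)
open import Relation.Binary.PropositionalEquality using (_≡_; _≢_)
open import Relation.Nullary using (¬_)

Digraph : ℕ → Set
Digraph n = Fin n → Fin n → Bool

data Walk⁺ {n : ℕ} (E : Digraph n) : Fin n → Fin n → Set where
  arc  : ∀ {u v} → E u v ≡ true → Walk⁺ E u v
  _∷ʷ_ : ∀ {u w v} → E u w ≡ true → Walk⁺ E w v → Walk⁺ E u v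

OnCycle : ∀ {n} → Digraph n → Fin n → Set
OnCycle E v = Walk⁺ E v v

-- v forms a trivial strong component.
Trivial : ∀ {n} → Digraph n → Fin n → Set
Trivial E v = ¬ OnCycle E v

Card : {A : Set} → (A → Set) → ℕ → Set
Card {A} P m = Σ (List A) λ xs → Unique xs × length xs ≡ m ×
  (∀ x → (x ∈ xs → P x) × (P x → x ∈ xs))

State : ℕ → ℕ → Set
State q n = Vec (Fin q) n

Map : ℕ → ℕ → Set
Map q n = State q n → State q n

DependsOn : ∀ {q n} → Map q n → Fin n → Fin n → Set
DependsOn {q} {n} f u v =
  Σ (State q n) λ x → Σ (Fin q) λ a → lookup (f x) v ≢ lookup (f (x [ u ]≔ a)) v

InF : ∀ {q n} → Digraph n → Map q n → Set
InF {q} {n} E f = ∀ u v → (E u v ≡ true → DependsOn f u v) × (DependsOn f u v → E u v ≡ true)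

VSet : ℕ → Set
VSet n = Vec Bool n

Schedule : ℕ → Set
Schedule n = List (VSet n)

update : ∀ {q n} → Map q n → VSet n → Map q n
update f S x = tabulate λ v → if lookup S v then lookup (f x) v else lookup x v

runSchedule : ∀ {q n} → Map q n → Schedule n → Map q n
runSchedule f [] x = x
runSchedule f (S ∷ σ) x = runSchedule f σ (update f S x)

Complete : ∀ {n} → Schedule n → Set
Complete {n} σ = ∀ (v : Fin n) → Σ (VSet n) λ S → S ∈ σ × lookup S v ≡ true

iter : ∀ {A : Set} → (A → A) → ℕ → A → A
iter g zero x = x
iter g (suc k) x = g (iter g k x)

Periodic : ∀ {A : Set} → (A → A) → A → Set
Periodic g x = Σ ℕ λ k → iter g (suc k) x ≡ x

{-# OPTIONS --safe #-}
module Submission where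

-- Upper bound: a trivial vertex v, once updated, carries a function of its strict ancestors, and
-- every coordinate of a periodic point has been updated.  Hence, by induction along ancestry, a
-- periodic point is determined by its restriction to the n ∸ t vertices lying on cycles.
--
-- Lower bound: q = 2 already attains n ∸ t.  Let f_v be the sum modulo 2 of the in-neighbours of
-- v, and let the schedule update, for each v in turn, either {v} if v is trivial, or all vertices
-- of a shortest closed walk through v.  The latter update is a bijection (cycle-injective), so
-- every f^σ-orbit remembers the initial values on the cycles: points that agree on the trivial
-- vertices and eventually meet are equal.  Running 2^n rounds thus sends the 2^(n ∸ t) points
-- vanishing on the trivial vertices injectively into the periodic points.

open import Defs
open import Data.Nat using (ℕ; _≤_; _<_; _^_; _*_; _∸_)
open import Data.Product using (Σ; _×_)
open import Data.Bool using (Bool; true; false; if_then_else_; not)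
import Data.Bool as Bool
open import Data.Nat using (zero; suc; _+_; z≤n; s≤s; _≤?_)
open import Data.Nat.Induction using (<-wellFounded)
import Data.Nat.Properties as ℕ
open import Data.Fin using (Fin; zero; suc; toℕ; fromℕ<; _≟_)
import Data.Fin as Fin
import Data.Fin.Properties as Fin
open import Data.Fin.Induction using (spo-wellFounded; >-wellFounded)
open import Data.Fin.Subset using (∣_∣; ∁)
import Data.Fin.Subset.Properties as Subset
open import Data.List using (List; []; _∷_; length; allFin; cartesianProductWith)
import Data.List as List
import Data.List.Properties as List
open import Data.List.Membership.Propositional using (_∈_; _∉_)
open import Data.List.Membership.Propositional.Properties
  using (∈-map⁺; ∈-map⁻; ∈-lookup; ∈-allFin; ∈-cartesianProductWith⁺;
         ∈-deduplicate⁺; ∈-deduplicate⁻)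
open import Data.List.Relation.Unary.All using (All; []; _∷_)
import Data.List.Relation.Unary.All as All
import Data.List.Relation.Unary.All.Properties as All
open import Data.List.Relation.Unary.AllPairs using ([]; _∷_)
open import Data.List.Relation.Unary.Any using (here; there; index)
open import Data.List.Relation.Unary.Any.Properties using (lookup-index)
open import Data.List.Relation.Unary.Unique.Propositional using (Unique)
import Data.List.Relation.Unary.Unique.Propositional.Properties as Unique
import Data.List.Relation.Unary.Unique.DecPropositional.Properties as DecUnique
open import Data.Product using (∃; ∃₂; _,_; proj₁; proj₂)
open import Data.Sum using (_⊎_; inj₁; inj₂)
open import Data.Vec using (Vec; []; _∷_; lookup; tabulate; replicate; _[_]≔_)
import Data.Vec.Properties as Vec
open import Function using (_∘_)
open import Function.Definitions using (Injective)
open import Induction.WellFounded using (Acc; acc; WellFounded)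
open import Relation.Binary using (tri<; tri≈; tri>)
open import Relation.Binary.PropositionalEquality
open import Relation.Nullary using (¬_; Dec; yes; no; does; contradiction; map′; _×-dec_)
open import Relation.Nullary.Decidable using (dec-true; dec-false; decidable-stable)

private variable
  A B : Set
  m n q : ℕ

-- Counting by injections between lists

lookup-unique : {xs : List A} → Unique xs →
  Injective _≡_ _≡_ (List.lookup xs)
lookup-unique (_ ∷ _) {zero} {zero} _ = refl
lookup-unique {xs = _ ∷ xs} (x∉ ∷ _) {zero} {suc j} eq =
  contradiction eq (All.lookup x∉ (∈-lookup {xs = xs} j))
lookup-unique {xs = _ ∷ xs} (x∉ ∷ _) {suc i} {zero} eq =
  contradiction (sym eq) (All.lookup x∉ (∈-lookup {xs = xs} i))
lookup-unique (_ ∷ u) {suc i} {suc j} eq = cong suc (lookup-unique u eq)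

-- `f` followed by the position in `ys` is an injection between index sets. Injectivity is asked on
-- members of `xs` only, so it may use what membership says, such as periodicity.
length-injection : {xs : List A} {ys : List B} (f : A → B) → Unique xs →
  (∀ {x} → x ∈ xs → f x ∈ ys) →
  (∀ {x y} → x ∈ xs → y ∈ xs → f x ≡ f y → x ≡ y) → length xs ≤ length ys
length-injection {xs = xs} {ys} f u f∈ inj = Fin.injective⇒≤ {f = pos} pos-injective
  where
  pos : Fin (length xs) → Fin (length ys)
  pos i = index (f∈ (∈-lookup {xs = xs} i))
  pos-injective : Injective _≡_ _≡_ pos
  pos-injective {i} {j} eq = lookup-unique u (inj (∈-lookup i) (∈-lookup j)
    (trans (lookup-index (f∈ (∈-lookup {xs = xs} i)))
      (trans (cong (List.lookup ys) eq) (sym (lookup-index (f∈ (∈-lookup {xs = xs} j)))))))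

length-cartesianProductWith : ∀ {C : Set} (f : A → B → C) xs ys →
  length (cartesianProductWith f xs ys) ≡ length xs * length ys
length-cartesianProductWith f [] ys = refl
length-cartesianProductWith f (x ∷ xs) ys =
  trans (List.length-++ (List.map (f x) ys))
    (cong₂ _+_ (List.length-map (f x) ys) (length-cartesianProductWith f xs ys))

allVecs : ∀ q r → List (Vec (Fin q) r)
allVecs q zero = [] ∷ []
allVecs q (suc r) = cartesianProductWith _∷_ (allFin q) (allVecs q r)

allVecs-unique : ∀ q r → Unique (allVecs q r)
allVecs-unique q zero = [] ∷ []
allVecs-unique q (suc r) =
  Unique.cartesianProductWith⁺ _∷_ Vec.∷-injective (Unique.allFin⁺ q) (allVecs-unique q r)

∈-allVecs : ∀ {r} (x : Vec (Fin q) r) → x ∈ allVecs q r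
∈-allVecs [] = here refl
∈-allVecs (a ∷ x) = ∈-cartesianProductWith⁺ _∷_ (∈-allFin a) (∈-allVecs x)

length-allVecs : ∀ q r → length (allVecs q r) ≡ q ^ r
length-allVecs q zero = refl
length-allVecs q (suc r) = trans (length-cartesianProductWith _∷_ (allFin q) (allVecs q r))
  (cong₂ _*_ (List.length-tabulate {n = q} (λ i → i)) (length-allVecs q r))

-- Subsets given by Boolean masks

elements : Vec Bool n → List (Fin n)
elements [] = []
elements (true ∷ p) = zero ∷ List.map suc (elements p)
elements (false ∷ p) = List.map suc (elements p)

length-elements : (p : Vec Bool n) → length (elements p) ≡ ∣ p ∣
length-elements [] = refl
length-elements (true ∷ p) = cong suc (trans (List.length-map suc (elements p)) (length-elements p))
length-elements (false ∷ p) = trans (List.length-map suc (elements p)) (length-elements p)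

elements-unique : (p : Vec Bool n) → Unique (elements p)
elements-unique [] = []
elements-unique (true ∷ p) =
  All.map⁺ (All.tabulate λ _ ()) ∷ Unique.map⁺ Fin.suc-injective (elements-unique p)
elements-unique (false ∷ p) = Unique.map⁺ Fin.suc-injective (elements-unique p)

∈-elements⁺ : (p : Vec Bool n) (v : Fin n) → lookup p v ≡ true → v ∈ elements p
∈-elements⁺ (true ∷ p) zero _ = here refl
∈-elements⁺ (true ∷ p) (suc v) eq = there (∈-map⁺ suc (∈-elements⁺ p v eq))
∈-elements⁺ (false ∷ p) (suc v) eq = ∈-map⁺ suc (∈-elements⁺ p v eq)

∈-elements⁻ : (p : Vec Bool n) {v : Fin n} → v ∈ elements p → lookup p v ≡ true
∈-elements⁻ (true ∷ p) (here refl) = refl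
∈-elements⁻ (true ∷ p) (there v∈) with ∈-map⁻ suc v∈
... | _ , w∈ , refl = ∈-elements⁻ p w∈
∈-elements⁻ (false ∷ p) v∈ with ∈-map⁻ suc v∈
... | _ , w∈ , refl = ∈-elements⁻ p w∈

gather : (p : Vec Bool n) → Vec A n → Vec A ∣ p ∣
gather [] [] = []
gather (true ∷ p) (a ∷ x) = a ∷ gather p x
gather (false ∷ p) (_ ∷ x) = gather p x

spread : A → (p : Vec Bool n) → Vec A ∣ p ∣ → Vec A n
spread d [] _ = []
spread d (true ∷ p) (a ∷ x) = a ∷ spread d p x
spread d (false ∷ p) x = d ∷ spread d p x

gather-injective : (p : Vec Bool n) (x y : Vec A n) → gather p x ≡ gather p y →
  ∀ v → lookup p v ≡ true → lookup x v ≡ lookup y v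
gather-injective (true ∷ p) (a ∷ x) (b ∷ y) eq zero _ = Vec.∷-injectiveˡ eq
gather-injective (true ∷ p) (a ∷ x) (b ∷ y) eq (suc v) pv =
  gather-injective p x y (Vec.∷-injectiveʳ eq) v pv
gather-injective (false ∷ p) (a ∷ x) (b ∷ y) eq (suc v) pv = gather-injective p x y eq v pv

spread-injective : (d : A) (p : Vec Bool n) {x y : Vec A ∣ p ∣} →
  spread d p x ≡ spread d p y → x ≡ y
spread-injective d [] {[]} {[]} _ = refl
spread-injective d (true ∷ p) {a ∷ x} {b ∷ y} eq =
  cong₂ _∷_ (Vec.∷-injectiveˡ eq) (spread-injective d p (Vec.∷-injectiveʳ eq))
spread-injective d (false ∷ p) eq = spread-injective d p (Vec.∷-injectiveʳ eq)

spread-outside : (d : A) (p : Vec Bool n) (x : Vec A ∣ p ∣) (v : Fin n) →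
  lookup p v ≡ false → lookup (spread d p x) v ≡ d
spread-outside d (true ∷ p) (a ∷ x) (suc v) eq = spread-outside d p x v eq
spread-outside d (false ∷ p) x zero _ = refl
spread-outside d (false ∷ p) x (suc v) eq = spread-outside d p x v eq

lookup-extensional : (x y : Vec A n) → (∀ v → lookup x v ≡ lookup y v) → x ≡ y
lookup-extensional x y eq =
  trans (sym (Vec.tabulate∘lookup x)) (trans (Vec.tabulate-cong eq) (Vec.tabulate∘lookup y))

does-true : (d : Dec A) → does d ≡ true → A
does-true (yes a) _ = a

-- Iteration

iter-+ : (g : A → A) → ∀ k l x → iter g (k + l) x ≡ iter g k (iter g l x)
iter-+ g zero l x = refl
iter-+ g (suc k) l x = cong g (iter-+ g k l x)

iter-comm : (g : A → A) → ∀ k l x → iter g k (iter g l x) ≡ iter g l (iter g k x)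
iter-comm g k l x = trans (sym (iter-+ g k l x))
  (trans (cong (λ i → iter g i x) (ℕ.+-comm k l)) (iter-+ g l k x))

iter-multiple : (g : A → A) (k : ℕ) {x : A} → iter g k x ≡ x → ∀ l → iter g (l * k) x ≡ x
iter-multiple g k eq zero = refl
iter-multiple g k {x} eq (suc l) =
  trans (iter-+ g k (l * k) x) (trans (cong (iter g k) (iter-multiple g k eq l)) eq)

module _ (xs : List A) (xs-full : ∀ x → x ∈ xs) (g : A → A) where

  iter-collision : ∀ x → ∃₂ λ i d → i ≤ length xs × iter g (suc d + i) x ≡ iter g i x
  iter-collision x
    with i , j , i<j , eq ← Fin.pigeonhole (ℕ.n<1+n (length xs))
      (λ (i : Fin (suc (length xs))) → index (xs-full (iter g (toℕ i) x)))
    = toℕ i , d , ℕ.≤-pred (Fin.toℕ<n i) ,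
      trans (cong (λ k → iter g k x) j≡) (sym same)
    where
    -- One less than the gap between `i` and `j`, so that the period `suc d` is positive.
    d = toℕ j ∸ suc (toℕ i)
    j≡ : suc d + toℕ i ≡ toℕ j
    j≡ = trans (sym (ℕ.+-suc d (toℕ i))) (ℕ.m∸n+n≡m i<j)
    same : iter g (toℕ i) x ≡ iter g (toℕ j) x
    same = trans (lookup-index (xs-full _))
      (trans (cong (List.lookup xs) eq) (sym (lookup-index (xs-full _))))

  -- `length xs` rounds outlast the pre-period of every point. Together with `periodic-in-image`
  -- this makes the periodic points exactly the image of `iter g (length xs)`.
  eventually-periodic : ∀ x → Periodic g (iter g (length xs) x)
  eventually-periodic x with i , d , i≤ , eq ← iter-collision x = d , (begin
    iter g (suc d) (iter g N x)               ≡⟨ cong (iter g (suc d)) split ⟩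
    iter g (suc d) (iter g (N ∸ i) (iter g i x)) ≡⟨ iter-comm g (suc d) (N ∸ i) (iter g i x) ⟩
    iter g (N ∸ i) (iter g (suc d) (iter g i x)) ≡⟨ cong (iter g (N ∸ i)) (sym (iter-+ g (suc d) i x)) ⟩
    iter g (N ∸ i) (iter g (suc d + i) x)     ≡⟨ cong (iter g (N ∸ i)) eq ⟩
    iter g (N ∸ i) (iter g i x)               ≡⟨ sym split ⟩
    iter g N x ∎)
    where
    open ≡-Reasoning
    N = length xs
    split : iter g N x ≡ iter g (N ∸ i) (iter g i x)
    split = trans (cong (λ k → iter g k x) (sym (ℕ.m∸n+n≡m i≤))) (iter-+ g (N ∸ i) i x)

  periodic-in-image : ∀ {x} → Periodic g x → ∃ λ y → iter g (length xs) y ≡ x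
  -- `N` further rounds make `suc k * N` in all, a multiple of the period `suc k`.
  periodic-in-image {x} (k , eq) = iter g (k * N) x ,
    trans (sym (iter-+ g N (k * N) x))
      (trans (cong (λ i → iter g i x) (ℕ.*-comm (suc k) N)) (iter-multiple g (suc k) eq N))
    where
    N = length xs

-- Walks of a given length

module _ (E : Digraph n) where

  Walk : ℕ → Fin n → Fin n → Set
  Walk zero u v = u ≡ v
  Walk (suc k) u v = ∃ λ w → E u w ≡ true × Walk k w v

  walk? : ∀ k u v → Dec (Walk k u v)
  walk? zero u v = u ≟ v
  walk? (suc k) u v = Fin.any? λ w → (E u w Bool.≟ true) ×-dec walk? k w v

  _++ʷ_ : ∀ {k l u v w} → Walk k u v → Walk l v w → Walk (k + l) u w
  _++ʷ_ {zero} refl q = q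
  _++ʷ_ {suc k} (_ , e , p) q = _ , e , p ++ʷ q

  toWalk : ∀ {u v} → Walk⁺ E u v → ∃ λ k → Walk (suc k) u v
  toWalk (arc e) = 0 , _ , e , refl
  toWalk (e ∷ʷ p) = suc (proj₁ (toWalk p)) , _ , e , proj₂ (toWalk p)

  fromWalk : ∀ k {u v} → Walk (suc k) u v → Walk⁺ E u v
  fromWalk zero (_ , e , refl) = arc e
  fromWalk (suc k) (_ , e , p) = e ∷ʷ fromWalk k p

  record Path (k : ℕ) (u v : Fin n) : Set where
    field
      at    : ℕ → Fin n
      start : at 0 ≡ u
      end   : at k ≡ v
      step  : ∀ i → i < k → E (at i) (at (suc i)) ≡ true

    segment : ∀ l i → l + i ≤ k → Walk l (at i) (at (l + i))
    segment zero i _ = refl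
    segment (suc l) i l+i≤k = at (suc i) , step i (ℕ.≤-trans (s≤s (ℕ.m≤n+m i l)) l+i≤k) ,
      subst (Walk l (at (suc i)) ∘ at) (ℕ.+-suc l i)
        (segment l (suc i) (subst (_≤ k) (sym (ℕ.+-suc l i)) l+i≤k))

    prefix : ∀ i → i ≤ k → Walk i u (at i)
    prefix i i≤k = subst₂ (Walk i) start (cong at (ℕ.+-identityʳ i))
      (segment i 0 (subst (_≤ k) (sym (ℕ.+-identityʳ i)) i≤k))

    suffix : ∀ i → i ≤ k → Walk (k ∸ i) (at i) v
    suffix i i≤k = subst (Walk (k ∸ i) (at i)) (trans (cong at (ℕ.m∸n+n≡m i≤k)) end)
      (segment (k ∸ i) i (ℕ.≤-reflexive (ℕ.m∸n+n≡m i≤k)))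

  toPath : ∀ k {u v} → Walk k u v → Path k u v
  toPath zero {u} refl = record { at = λ _ → u ; start = refl ; end = refl ; step = λ _ () }
  toPath (suc k) {u} (w , e , p) = record
    { at = at′ ; start = refl ; end = end ; step = step′ }
    where
    open Path (toPath k p)
    at′ : ℕ → Fin n
    at′ zero = u
    at′ (suc i) = at i
    step′ : ∀ i → i < suc k → E (at′ i) (at′ (suc i)) ≡ true
    step′ zero _ = trans (cong (E u) start) e
    step′ (suc i) (s≤s i<k) = step i i<k

  record Shortest (k : ℕ) (u v : Fin n) : Set where
    field
      path    : Path (suc k) u v
      minimal : ∀ l → l < k → ¬ Walk (suc l) u v
    open Path path public

    -- A shortcut followed by the remaining `k ∸ i` arcs would be a walk of length
    -- `suc (j + (k ∸ i))`, below `suc k`.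
    no-shortcut : ∀ {i j} → j < i → i ≤ k → ¬ Walk (suc j) u (at (suc i))
    no-shortcut {i} {j} j<i i≤k w = minimal (j + (k ∸ i))
      (subst (j + (k ∸ i) <_) (ℕ.m+[n∸m]≡n i≤k) (ℕ.+-monoˡ-< (k ∸ i) j<i))
      (w ++ʷ suffix (suc i) (s≤s i≤k))

    no-chord : ∀ {i j} → j < i → i ≤ k → E (at j) (at (suc i)) ≢ true
    no-chord {i} {j} j<i i≤k e = no-shortcut j<i i≤k
      (subst (λ l → Walk l u (at (suc i))) (ℕ.+-comm j 1)
        (prefix j (ℕ.m≤n⇒m≤1+n (ℕ.≤-trans (ℕ.<⇒≤ j<i) i≤k)) ++ʷ (_ , e , refl)))

    -- If `n ≤ k`, two of the `suc k` vertices after the start coincide, and the prefix ending at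
    -- the earlier one is a shortcut to the later one.
    bounded : k < n
    bounded with n ≤? k
    ... | no n≰k = ℕ.≰⇒> n≰k
    ... | yes n≤k with Fin.pigeonhole (s≤s n≤k) (λ (i : Fin (suc k)) → at (suc (toℕ i)))
    ... | j , i , j<i , eq = contradiction
      (subst (Walk (suc (toℕ j)) u) eq (prefix (suc (toℕ j)) (Fin.toℕ<n j)))
      (no-shortcut j<i (ℕ.≤-pred (Fin.toℕ<n i)))

  shortest : ∀ {u v} → Walk⁺ E u v → ∃ λ k → Shortest k u v
  shortest {u} {v} p = go _ (<-wellFounded _) (proj₂ (toWalk p))
    where
    go : ∀ k → Acc _<_ k → Walk (suc k) u v → ∃ λ k → Shortest k u v
    go k (acc rs) w with ℕ.anyUpTo? (λ l → walk? (suc l) u v) k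
    ... | yes (l , l<k , w′) = go l (rs l<k) w′
    ... | no none = k , record
      { path = toPath (suc k) w ; minimal = λ l l<k w′ → none (l , l<k , w′) }

  -- A shortest walk has at most `n` arcs, which leaves finitely many lengths to search.
  reach? : ∀ u v → Dec (Walk⁺ E u v)
  reach? u v = map′ (λ (l , _ , w) → fromWalk l w) short (ℕ.anyUpTo? (λ l → walk? (suc l) u v) n)
    where
    short : Walk⁺ E u v → ∃ λ k → k < n × Walk (suc k) u v
    short p with k , s ← shortest p =
      k , bounded s , subst (Walk (suc k) u) (end s) (prefix s (suc k) ℕ.≤-refl)
      where open Shortest

  _++⁺_ : ∀ {u v w} → Walk⁺ E u v → Walk⁺ E v w → Walk⁺ E u w
  arc e ++⁺ q = e ∷ʷ q
  (e ∷ʷ p) ++⁺ q = e ∷ʷ (p ++⁺ q)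

  TrivialAncestor : Fin n → Fin n → Set
  TrivialAncestor u v = Walk⁺ E u v × Trivial E u

  -- Ancestry itself may be cyclic; a trivial source makes it irreflexive, hence a strict partial
  -- order on a finite set. This order carries the inductions of both bounds.
  trivialAncestor-wellFounded : WellFounded TrivialAncestor
  trivialAncestor-wellFounded = spo-wellFounded record
    { isEquivalence = isEquivalence
    ; irrefl = λ { refl (p , t) → t p }
    ; trans = λ (p , t) (q , _) → p ++⁺ q , t
    ; <-resp-≈ = (λ { refl r → r }) , (λ { refl r → r })
    }

  -- On such a set the next values depend only on values in the set, so agreement there survives
  -- every update.
  PredClosed : (Fin n → Set) → Set
  PredClosed P = ∀ {u w} → E u w ≡ true → P w → P u

  Anc : Fin n → Fin n → Set
  Anc v u = Walk⁺ E u v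

  Anc⁼ : Fin n → Fin n → Set
  Anc⁼ v u = u ≡ v ⊎ Walk⁺ E u v

  anc-closed : ∀ {v} → PredClosed (Anc v)
  anc-closed e p = e ∷ʷ p

  anc⁼-pred : ∀ {u w v} → E u w ≡ true → Anc⁼ v w → Walk⁺ E u v
  anc⁼-pred e (inj₁ refl) = arc e
  anc⁼-pred e (inj₂ p) = e ∷ʷ p

  anc⁼-closed : ∀ {v} → PredClosed (Anc⁼ v)
  anc⁼-closed e p = inj₂ (anc⁼-pred e p)

AgreeOn : (Fin n → Set) → State q n → State q n → Set
AgreeOn P x y = ∀ u → P u → lookup x u ≡ lookup y u

-- Schedules

lookup-update : ∀ (f : Map q n) S x v →
  lookup (update f S x) v ≡ (if lookup S v then lookup (f x) v else lookup x v)
lookup-update f S x = Vec.lookup∘tabulate _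

update-inside : ∀ (f : Map q n) S x {v} → lookup S v ≡ true →
  lookup (update f S x) v ≡ lookup (f x) v
update-inside f S x {v} Sv = trans (lookup-update f S x v) (cong (if_then _ else _) Sv)

update-outside : ∀ (f : Map q n) S x {v} → lookup S v ≡ false →
  lookup (update f S x) v ≡ lookup x v
update-outside f S x {v} Sv = trans (lookup-update f S x v) (cong (if_then _ else _) Sv)

module _ {E : Digraph n} {f : Map q n} (f∈F : InF E f) where

  -- `DependsOn` speaks of one changed coordinate, so `x` is turned into `y` one coordinate at a
  -- time; `us` lists those where the two may still differ.
  local : ∀ {v} (x y : State q n) → (∀ u → E u v ≡ true → lookup x u ≡ lookup y u) →
    lookup (f x) v ≡ lookup (f y) v
  local {v} x y = go (allFin n) x (λ w w∉ → contradiction (∈-allFin w) w∉)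
    where
    go : ∀ us x → (∀ w → w ∉ us → lookup x w ≡ lookup y w) →
      (∀ u → E u v ≡ true → lookup x u ≡ lookup y u) → lookup (f x) v ≡ lookup (f y) v
    go [] x out _ = cong (λ z → lookup (f z) v) (lookup-extensional x y λ w → out w λ ())
    go (u ∷ us) x out agree = trans step (go us x′ out′ agree′)
      where
      x′ = x [ u ]≔ lookup y u
      step : lookup (f x) v ≡ lookup (f x′) v
      -- If `u` is an in-neighbour, the values agree there already and `x′` equals `x`; otherwise a
      -- change would witness a dependence on `u`.
      step with E u v in eq
      ... | true = cong (λ z → lookup (f z) v)
        (sym (trans (cong (x [ u ]≔_) (sym (agree u eq))) (Vec.[]≔-lookup x u)))
      ... | false = decidable-stable (_ ≟ _) λ neq →
        contradiction (trans (sym eq) (proj₂ (f∈F u v) (x , lookup y u , neq))) λ ()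
      keep : ∀ w → (w ≢ u → lookup x w ≡ lookup y w) → lookup x′ w ≡ lookup y w
      keep w eq with w ≟ u
      ... | yes refl = Vec.lookup∘update u x (lookup y u)
      ... | no w≢u = trans (Vec.lookup∘update′ w≢u x (lookup y u)) (eq w≢u)
      out′ : ∀ w → w ∉ us → lookup x′ w ≡ lookup y w
      out′ w w∉ = keep w λ w≢u → out w λ { (here eq) → w≢u eq ; (there w∈) → w∉ w∈ }
      agree′ : ∀ w → E w v ≡ true → lookup x′ w ≡ lookup y w
      agree′ w e = keep w λ _ → agree w e

  module _ {P : Fin n → Set} (closed : PredClosed E P) where

    update-agree : ∀ S x y → AgreeOn P x y → AgreeOn P (update f S x) (update f S y)
    update-agree S x y agree v Pv with lookup S v in Sv
    ... | true = trans (update-inside f S x Sv)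
      (trans (local x y λ u e → agree u (closed e Pv)) (sym (update-inside f S y Sv)))
    ... | false = trans (update-outside f S x Sv)
      (trans (agree v Pv) (sym (update-outside f S y Sv)))

    run-agree : ∀ σ x y → AgreeOn P x y → AgreeOn P (runSchedule f σ x) (runSchedule f σ y)
    run-agree [] x y agree = agree
    run-agree (S ∷ σ) x y agree = run-agree σ _ _ (update-agree S x y agree)

    iter-agree : ∀ σ k x y → AgreeOn P x y →
      AgreeOn P (iter (runSchedule f σ) k x) (iter (runSchedule f σ) k y)
    iter-agree σ zero x y agree = agree
    iter-agree σ (suc k) x y agree = run-agree σ _ _ (iter-agree σ k x y agree)

  -- Updating v overwrites its value by a function of its strict ancestors.
  run-agree-at : ∀ {v} σ {S} x y → S ∈ σ → lookup S v ≡ true → AgreeOn (Anc E v) x y →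
    AgreeOn (Anc⁼ E v) (runSchedule f σ x) (runSchedule f σ y)
  run-agree-at {v} (S ∷ σ) x y (here refl) Sv agree =
    run-agree (anc⁼-closed E) σ _ _ λ where
      u (inj₁ refl) → trans (update-inside f S x Sv)
        (trans (local x y λ w e → agree w (arc e)) (sym (update-inside f S y Sv)))
      u (inj₂ p) → update-agree (anc-closed E) S x y agree u p
  run-agree-at (S ∷ σ) x y (there S′∈) Sv agree =
    run-agree-at σ _ _ S′∈ Sv (update-agree (anc-closed E) S x y agree)

  -- Induction over trivial ancestors. The strict ancestors of a trivial `v` lie on cycles or come
  -- earlier in this order, so they agree at the start of every round, and the update of `v` during
  -- a round makes the two runs agree at `v` as well.
  periodic-determined : ∀ σ → Complete σ → ∀ {x y} →
    Periodic (runSchedule f σ) x → Periodic (runSchedule f σ) y →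
    (∀ v → OnCycle E v → lookup x v ≡ lookup y v) → x ≡ y
  periodic-determined σ complete {x} {y} (a , xa) (b , yb) agree =
    lookup-extensional x y λ v → go v (trivialAncestor-wellFounded E v)
    where
    g = runSchedule f σ
    go : ∀ v → Acc (TrivialAncestor E) v → lookup x v ≡ lookup y v
    go v (acc rs) with reach? E v v
    ... | yes p = agree v p
    ... | no ¬p with S , S∈σ , Sv ← complete v = subst₂ (λ x′ y′ → lookup x′ v ≡ lookup y′ v)
      (trans (cong (λ k → iter g k x) (ℕ.*-comm (suc a) (suc b))) (iter-multiple g (suc a) xa (suc b)))
      (iter-multiple g (suc b) yb (suc a))
      -- `b + a * suc b` is one less than `suc a * suc b`, a multiple of both periods: one more
      -- round overwrites `v` and brings both points back.
      (run-agree-at σ _ _ S∈σ Sv (iter-agree (anc-closed E) σ (b + a * suc b) x y ancestors)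
        v (inj₁ refl))
      where
      ancestors : AgreeOn (Anc E v) x y
      ancestors u u→v with reach? E u u
      ... | yes p = agree u p
      ... | no t = go u (rs (u→v , t))

-- The parity network

xor : Fin 2 → Fin 2 → Fin 2
xor zero b = b
xor (suc zero) zero = suc zero
xor (suc zero) (suc zero) = zero

xor-cancelˡ : ∀ a {b c} → xor a b ≡ xor a c → b ≡ c
xor-cancelˡ zero eq = eq
xor-cancelˡ (suc zero) {zero} {zero} _ = refl
xor-cancelˡ (suc zero) {zero} {suc zero} ()
xor-cancelˡ (suc zero) {suc zero} {zero} ()
xor-cancelˡ (suc zero) {suc zero} {suc zero} _ = refl

xor-cancelʳ : ∀ a {b c} → xor b a ≡ xor c a → b ≡ c
xor-cancelʳ _ {zero} {zero} _ = refl
xor-cancelʳ zero {zero} {suc zero} ()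
xor-cancelʳ (suc zero) {zero} {suc zero} ()
xor-cancelʳ zero {suc zero} {zero} ()
xor-cancelʳ (suc zero) {suc zero} {zero} ()
xor-cancelʳ _ {suc zero} {suc zero} _ = refl

parity : (Fin n → Fin 2) → Fin 2
parity {zero} h = zero
parity {suc n} h = xor (h zero) (parity (h ∘ suc))

parity-cong : {h h′ : Fin n → Fin 2} → (∀ w → h w ≡ h′ w) → parity h ≡ parity h′
parity-cong {zero} eq = refl
parity-cong {suc n} eq = cong₂ xor (eq zero) (parity-cong (eq ∘ suc))

-- Addition modulo 2 is cancellative, so the sum and all other summands determine the summand at
-- `a`.
parity-cancel : {h h′ : Fin n → Fin 2} (a : Fin n) → (∀ w → w ≢ a → h w ≡ h′ w) →
  parity h ≡ parity h′ → h a ≡ h′ a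
parity-cancel {h = h} {h′} zero same eq = xor-cancelʳ (parity (h ∘ suc))
  (trans eq (cong (xor (h′ zero)) (parity-cong λ w → sym (same (suc w) λ ()))))
parity-cancel {h = h} {h′} (suc a) same eq = parity-cancel a
  (λ w w≢a → same (suc w) (w≢a ∘ Fin.suc-injective))
  (xor-cancelˡ (h zero) (trans eq (cong (λ b → xor b (parity (h′ ∘ suc))) (sym (same zero λ ())))))

module _ (E : Digraph n) where

  input : Fin n → State 2 n → Fin n → Fin 2
  input v x u = if E u v then lookup x u else zero

  parityMap : Map 2 n
  parityMap x = tabulate λ v → parity (input v x)

  input-cong : ∀ {v} x y u → (E u v ≡ true → lookup x u ≡ lookup y u) → input v x u ≡ input v y u
  input-cong {v} x y u eq with E u v
  ... | true = eq refl
  ... | false = refl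

  parityMap-cancel : ∀ {a v} x y → E a v ≡ true →
    (∀ w → E w v ≡ true → w ≢ a → lookup x w ≡ lookup y w) →
    lookup (parityMap x) v ≡ lookup (parityMap y) v → lookup x a ≡ lookup y a
  parityMap-cancel {a} {v} x y e same eq =
    subst (λ b → (if b then lookup x a else zero) ≡ (if b then lookup y a else zero)) e
      (parity-cancel a (λ w w≢a → input-cong x y w λ e′ → same w e′ w≢a)
        (trans (sym (Vec.lookup∘tabulate _ v)) (trans eq (Vec.lookup∘tabulate _ v))))

  parityMap∈F : InF E parityMap
  parityMap∈F u v = depends , arc-of
    where
    0ⁿ : State 2 n
    0ⁿ = replicate n zero
    1ᵘ = 0ⁿ [ u ]≔ suc zero
    depends : E u v ≡ true → DependsOn parityMap u v
    -- Zero against the unit vector at `u`: equal outputs would cancel down to `zero ≡ suc zero`.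
    depends e = 0ⁿ , suc zero , λ eq → contradiction
      (trans (sym (Vec.lookup-replicate u zero))
        (trans (parityMap-cancel 0ⁿ 1ᵘ e
            (λ w _ w≢u → sym (Vec.lookup∘update′ w≢u 0ⁿ (suc zero))) eq)
          (Vec.lookup∘update u 0ⁿ (suc zero))))
      λ ()
    arc-of : DependsOn parityMap u v → E u v ≡ true
    arc-of (x , a , neq) with E u v in euv
    ... | true = refl
    ... | false = contradiction
      (trans (Vec.lookup∘tabulate _ v) (trans (parity-cong unchanged) (sym (Vec.lookup∘tabulate _ v))))
      neq
      where
      unchanged : ∀ w → input v x w ≡ input v (x [ u ]≔ a) w
      unchanged w = input-cong x (x [ u ]≔ a) w λ e →
        sym (Vec.lookup∘update′ (λ { refl → contradiction (trans (sym euv) e) λ () }) x a)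

  -- Updating a shortest closed walk

  module _ {k : ℕ} {v : Fin n} (cycle : Shortest E k v v) where
    open Shortest cycle

    -- Positions `0` to `k` cover the walk, as position `suc k` is the start again.
    Visited : Fin n → Set
    Visited w = ∃ λ (i : Fin (suc k)) → at (toℕ i) ≡ w

    visited? : ∀ w → Dec (Visited w)
    visited? w = Fin.any? λ i → at (toℕ i) ≟ w

    cycleSet : VSet n
    cycleSet = tabulate λ w → does (visited? w)

    visited⇒∈ : ∀ {w} → Visited w → lookup cycleSet w ≡ true
    visited⇒∈ {w} vis = trans (Vec.lookup∘tabulate _ w) (dec-true (visited? w) vis)

    ∈⇒visited : ∀ {w} → lookup cycleSet w ≡ true → Visited w
    ∈⇒visited {w} eq =
      does-true (visited? w) (trans (sym (Vec.lookup∘tabulate (λ w → does (visited? w)) w)) eq)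

    at-visited : ∀ {i} → i ≤ k → Visited (at i)
    at-visited i≤k = fromℕ< (s≤s i≤k) , cong at (Fin.toℕ-fromℕ< (s≤s i≤k))

    at-suc-visited : ∀ {i} → i ≤ k → Visited (at (suc i))
    at-suc-visited {i} i≤k with ℕ.m≤n⇒m<n∨m≡n i≤k
    ... | inj₁ i<k = at-visited i<k
    ... | inj₂ refl = zero , trans start (sym end)

    module _ {P : Fin n → Set} (closed : PredClosed E P) where

      back : ∀ i j → i ≤ j → j ≤ suc k → P (at j) → P (at i)
      back i j i≤j j≤k Pj with ℕ.m≤n⇒m<n∨m≡n i≤j
      ... | inj₂ refl = Pj
      back i (suc j) i≤j j≤k Pj | inj₁ (s≤s i≤j′) =
        back i j i≤j′ (ℕ.<⇒≤ j≤k) (closed (step j j≤k) Pj)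

      -- Stepping back from the given vertex reaches the start, which is also position `suc k`;
      -- stepping back from there passes every vertex of the cycle.
      cycle⊆ : ∀ {w} → Visited w → P w → ∀ i → i ≤ suc k → P (at i)
      cycle⊆ (j , refl) Pw i i≤k = back i (suc k) i≤k ℕ.≤-refl
        (subst P (trans start (sym end))
          (back 0 (toℕ j) z≤n (ℕ.<⇒≤ (Fin.toℕ<n j)) Pw))

      -- Solve for the c_i downwards: as the cycle has no chord c_j → c_{i+1} with j < i, the only
      -- input of c_{i+1} that is still unknown is c_i.
      cycle-injective : ∀ x y →
        AgreeOn P (update parityMap cycleSet x) (update parityMap cycleSet y) → AgreeOn P x y
      cycle-injective x y agree w Pw with lookup cycleSet w in Sw
      ... | false = trans (sym (update-outside parityMap cycleSet x Sw))
        (trans (agree w Pw) (update-outside parityMap cycleSet y Sw))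
      ... | true with ∈⇒visited Sw
      ... | i , refl = solve i (>-wellFounded i)
        where
        P-at : ∀ j → j ≤ suc k → P (at j)
        P-at = cycle⊆ (i , refl) Pw
        solve : (i : Fin (suc k)) → Acc Fin._>_ i → lookup x (at (toℕ i)) ≡ lookup y (at (toℕ i))
        solve i (acc rs) = parityMap-cancel x y (step (toℕ i) (Fin.toℕ<n i)) others
          (trans (sym (update-inside parityMap cycleSet x next∈))
            (trans (agree _ (P-at _ (Fin.toℕ<n i))) (update-inside parityMap cycleSet y next∈)))
          where
          i≤k : toℕ i ≤ k
          i≤k = ℕ.≤-pred (Fin.toℕ<n i)
          next∈ : lookup cycleSet (at (suc (toℕ i))) ≡ true
          next∈ = visited⇒∈ (at-suc-visited i≤k)
          others : ∀ w → E w (at (suc (toℕ i))) ≡ true → w ≢ at (toℕ i) → lookup x w ≡ lookup y w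
          others w e w≢ with lookup cycleSet w in Sw
          ... | false = trans (sym (update-outside parityMap cycleSet x Sw))
            (trans (agree w (closed e (P-at _ (Fin.toℕ<n i)))) (update-outside parityMap cycleSet y Sw))
          ... | true with ∈⇒visited Sw
          ... | j , refl with Fin.<-cmp j i
          ... | tri< j<i _ _ = contradiction e (no-chord j<i i≤k)
          ... | tri≈ _ refl _ = contradiction refl w≢
          ... | tri> _ _ j>i = solve j (rs j>i)

  -- Schedules built from blocks

  data Block : VSet n → Set where
    trivial : ∀ {S} → (∀ w → lookup S w ≡ true → Trivial E w) → Block S
    cyclic  : ∀ {k v} (c : Shortest E k v v) → Block (cycleSet c)

  block : ∀ v → ∃ λ S → lookup S v ≡ true × Block S
  block v with reach? E v v
  ... | no t = S , trans (Vec.lookup∘tabulate _ v) (dec-true (v ≟ v) refl) , trivial only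
    where
    S = tabulate λ w → does (w ≟ v)
    only : ∀ w → lookup S w ≡ true → Trivial E w
    only w eq
      with refl ← does-true (w ≟ v) (trans (sym (Vec.lookup∘tabulate (λ w → does (w ≟ v)) w)) eq) = t
  ... | yes p with k , c ← shortest E p =
    cycleSet c , visited⇒∈ c (zero , Shortest.start c) , cyclic c

  -- The trivial strict ancestors of `v` with all their own ancestors added, so that the set is
  -- predecessor-closed and agreement on it is kept along a run.
  AncTrivial : Fin n → Fin n → Set
  AncTrivial v u = ∃ λ w → TrivialAncestor E w v × Anc⁼ E w u

  ancTrivial-closed : ∀ {v} → PredClosed E (AncTrivial v)
  ancTrivial-closed e (w , t , p) = w , t , anc⁼-closed E e p

  -- A cyclic block can be undone on any predecessor-closed set. A trivial block overwrites only
  -- trivial vertices, and those among the strict ancestors of `v` lie in `AncTrivial v`, where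
  -- agreement is given.
  block-injective : ∀ {v S} x y → Block S → AgreeOn (AncTrivial v) x y →
    AgreeOn (Anc E v) (update parityMap S x) (update parityMap S y) → AgreeOn (Anc E v) x y
  block-injective x y (cyclic c) _ agree = cycle-injective c (anc-closed E) x y agree
  block-injective {S = S} x y (trivial t) triv agree u u→v with lookup S u in Su
  ... | true = triv u (u , (u→v , t u Su) , inj₁ refl)
  ... | false = trans (sym (update-outside parityMap S x Su))
    (trans (agree u u→v) (update-outside parityMap S y Su))

  -- Agreement on `AncTrivial v` is carried forwards through the schedule; agreement on `Anc E v` is
  -- pulled back from its end.
  run-injective : ∀ {v} σ x y → All Block σ → AgreeOn (AncTrivial v) x y →
    AgreeOn (Anc E v) (runSchedule parityMap σ x) (runSchedule parityMap σ y) →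
    AgreeOn (Anc E v) x y
  run-injective [] x y _ _ agree = agree
  run-injective (S ∷ σ) x y (b ∷ bs) triv agree = block-injective x y b triv
    (run-injective σ _ _ bs (update-agree {f = parityMap} parityMap∈F ancTrivial-closed S x y triv) agree)

  iter-injective : ∀ {v} σ x y → All Block σ → AgreeOn (AncTrivial v) x y → ∀ k →
    AgreeOn (Anc E v) (iter (runSchedule parityMap σ) k x) (iter (runSchedule parityMap σ) k y) →
    AgreeOn (Anc E v) x y
  iter-injective σ x y bs triv zero agree = agree
  iter-injective σ x y bs triv (suc k) agree = iter-injective σ x y bs triv k
    (run-injective σ _ _ bs (iter-agree {f = parityMap} parityMap∈F ancTrivial-closed σ k x y triv) agree)

  -- Induction over trivial ancestors: the hypothesis at each of them gives agreement on
  -- `AncTrivial v`, so equality after `k` rounds pulls back to all strict ancestors of `v`. Those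
  -- include `v` if it lies on a cycle; otherwise `v` is trivial and agrees by assumption.
  orbit-injective : ∀ {x y} σ → All Block σ → ∀ k →
    (∀ v → Trivial E v → lookup x v ≡ lookup y v) →
    iter (runSchedule parityMap σ) k x ≡ iter (runSchedule parityMap σ) k y → x ≡ y
  orbit-injective {x} {y} σ bs k triv eq = lookup-extensional x y λ v →
    go v (trivialAncestor-wellFounded E v) v (inj₁ refl)
    where
    go : ∀ v → Acc (TrivialAncestor E) v → AgreeOn (Anc⁼ E v) x y
    go v (acc rs) = λ where
        u (inj₂ u→v) → ancestors u u→v
        u (inj₁ refl) → self
      where
      ancestors : AgreeOn (Anc E v) x y
      ancestors = iter-injective σ x y bs
        (λ u (w , t , p) → go w (rs t) u p) k (λ u _ → cong (λ z → lookup z u) eq)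
      self : lookup x v ≡ lookup y v
      self with reach? E v v
      ... | yes p = ancestors v p
      ... | no t = triv v t

  blockSchedule : Schedule n
  blockSchedule = List.map (proj₁ ∘ block) (allFin n)

  blockSchedule-complete : Complete blockSchedule
  blockSchedule-complete v =
    proj₁ (block v) , ∈-map⁺ (proj₁ ∘ block) (∈-allFin v) , proj₁ (proj₂ (block v))

  blockSchedule-blocks : All Block blockSchedule
  blockSchedule-blocks = All.map⁺ (All.tabulate λ {v} _ → proj₂ (proj₂ (block v)))

  -- Counting periodic points

  cycleMask : VSet n
  cycleMask = tabulate λ v → does (reach? E v v)

  cycleMask-onCycle : ∀ {v} → OnCycle E v → lookup cycleMask v ≡ true
  cycleMask-onCycle {v} p = trans (Vec.lookup∘tabulate _ v) (dec-true (reach? E v v) p)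

  cycleMask-trivial : ∀ {v} → Trivial E v → lookup cycleMask v ≡ false
  cycleMask-trivial {v} t = trans (Vec.lookup∘tabulate _ v) (dec-false (reach? E v v) t)

  ∣cycleMask∣ : ∀ {t} → Card (Trivial E) t → ∣ cycleMask ∣ ≡ n ∸ t
  ∣cycleMask∣ (ts , ts-unique , refl , ts⇔) = sym (begin
    n ∸ length ts           ≡⟨ cong (n ∸_) (ℕ.≤-antisym ts≤ ≤ts) ⟩
    n ∸ length es           ≡⟨ cong (n ∸_) (trans (length-elements (∁ M)) (Subset.∣∁p∣≡n∸∣p∣ M)) ⟩
    n ∸ (n ∸ ∣ M ∣)         ≡⟨ ℕ.m∸[m∸n]≡n (Subset.∣p∣≤n M) ⟩
    ∣ M ∣ ∎)
    where
    open ≡-Reasoning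
    M = cycleMask
    es = elements (∁ M)
    lookup-∁ : ∀ v → lookup (∁ M) v ≡ not (lookup M v)
    lookup-∁ v = Vec.lookup-map v not M
    ts≤ : length ts ≤ length es
    ts≤ = length-injection (λ v → v) ts-unique (λ {v} v∈ → ∈-elements⁺ (∁ M) v
      (trans (lookup-∁ v) (cong not (cycleMask-trivial (proj₁ (ts⇔ v) v∈))))) (λ _ _ eq → eq)
    ≤ts : length es ≤ length ts
    ≤ts = length-injection (λ v → v) (elements-unique (∁ M)) (λ {v} v∈ → proj₂ (ts⇔ v) λ p →
      contradiction (trans (sym (∈-elements⁻ (∁ M) v∈))
        (trans (lookup-∁ v) (cong not (cycleMask-onCycle p)))) λ ()) (λ _ _ eq → eq)

periodic-count-≤ : ∀ {E : Digraph n} {f : Map q n} → InF E f → ∀ {σ} → Complete σ →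
  Card (Periodic (runSchedule f σ)) m → m ≤ q ^ ∣ cycleMask E ∣
periodic-count-≤ {q = q} {E = E} f∈F {σ} complete (xs , xs-unique , refl , xs⇔) =
  subst (length xs ≤_) (length-allVecs q ∣ M ∣)
    (length-injection (gather M) xs-unique (λ _ → ∈-allVecs _) λ {x} {y} x∈ y∈ eq →
      periodic-determined f∈F σ complete (proj₁ (xs⇔ x) x∈) (proj₁ (xs⇔ y) y∈)
        λ v p → gather-injective M x y eq v (cycleMask-onCycle E p))
  where M = cycleMask E

periodic-count-≥ : (E : Digraph n) →
  ∃ λ m → Card (Periodic (runSchedule (parityMap E) (blockSchedule E))) m × 2 ^ ∣ cycleMask E ∣ ≤ m
periodic-count-≥ {n} E = length ps ,
  (ps , DecUnique.deduplicate-! _≟ᵛ_ _ , refl , λ x → ps-sound x , ps-complete x) ,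
  subst (_≤ length ps) (length-allVecs 2 ∣ M ∣)
    (length-injection (iter g N ∘ spread zero M) (allVecs-unique 2 ∣ M ∣)
      (λ _ → iter∈ps _)
      λ {x} {y} _ _ eq → spread-injective zero M
        (orbit-injective E (blockSchedule E) (blockSchedule-blocks E) N
          (λ v t → let out = cycleMask-trivial E t in
            trans (spread-outside zero M x v out) (sym (spread-outside zero M y v out)))
          eq))
  where
  M = cycleMask E
  g = runSchedule (parityMap E) (blockSchedule E)
  states = allVecs 2 n
  N = length states
  _≟ᵛ_ = Vec.≡-dec {n = n} (Fin._≟_ {2})
  -- `N` rounds carry every state to a periodic point and reach each periodic point; deduplication
  -- yields the list that `Card` asks for.
  ps = List.deduplicate _≟ᵛ_ (List.map (iter g N) states)
  iter∈ps : ∀ x → iter g N x ∈ ps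
  iter∈ps x = ∈-deduplicate⁺ _≟ᵛ_ (∈-map⁺ (iter g N) (∈-allVecs x))
  ps-sound : ∀ x → x ∈ ps → Periodic g x
  ps-sound x x∈ with ∈-map⁻ (iter g N) (∈-deduplicate⁻ _≟ᵛ_ (List.map (iter g N) states) x∈)
  ... | y , _ , refl = eventually-periodic states ∈-allVecs g y
  ps-complete : ∀ x → Periodic g x → x ∈ ps
  ps-complete x p with y , refl ← periodic-in-image states ∈-allVecs g p = iter∈ps y

-- The supremum without logarithms: the first half is `per ≤ n - t`. The second, after taking
-- logarithms to base `q` and dividing by `k`, is `per > n - t - 1/k` for every `k ≥ 1`.
theorem6 : (n : ℕ) (E : Digraph n) (t : ℕ) → Card (Trivial E) t →
    ((q : ℕ) → 2 ≤ q → (f : Map q n) → InF E f → (σ : Schedule n) → Complete σ →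
    (m : ℕ) → Card (Periodic (runSchedule f σ)) m → m ≤ q ^ (n ∸ t))
    × ((k : ℕ) → 1 ≤ k → Σ ℕ λ q → 2 ≤ q × Σ (Map q n) λ f → InF E f ×
    Σ (Schedule n) λ σ → Complete σ × Σ ℕ λ m → Card (Periodic (runSchedule f σ)) m ×
    q ^ (k * (n ∸ t)) < m ^ k * q)
theorem6 n E t card-t = upper , lower
  where
  upper : (q : ℕ) → 2 ≤ q → (f : Map q n) → InF E f → (σ : Schedule n) → Complete σ →
    (m : ℕ) → Card (Periodic (runSchedule f σ)) m → m ≤ q ^ (n ∸ t)
  upper q _ f f∈F σ complete m card-m = subst (λ r → m ≤ q ^ r) (∣cycleMask∣ E card-t)
    (periodic-count-≤ {E = E} {f} f∈F {σ} complete card-m)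
  -- The exponent is abstracted so that it can be rewritten from the size of the mask to `n ∸ t`.
  AtLeast : ℕ → Set
  AtLeast r =
    ∃ λ m → Card (Periodic (runSchedule (parityMap E) (blockSchedule E))) m × 2 ^ r ≤ m
  lower : (k : ℕ) → 1 ≤ k → Σ ℕ λ q → 2 ≤ q × Σ (Map q n) λ f → InF E f ×
    Σ (Schedule n) λ σ → Complete σ × Σ ℕ λ m → Card (Periodic (runSchedule f σ)) m ×
    q ^ (k * (n ∸ t)) < m ^ k * q
  lower k _ with m , card-m , 2^r≤m ← subst AtLeast (∣cycleMask∣ E card-t) (periodic-count-≥ E) =
    2 , ℕ.≤-refl , parityMap E , parityMap∈F E , blockSchedule E , blockSchedule-complete E ,
    m , card-m , (begin-strict
      2 ^ (k * r)      ≡⟨ cong (2 ^_) (ℕ.*-comm k r) ⟩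
      -- Strictness comes from the spare factor `q = 2`, as `m` is only known to be at least
      -- `2 ^ r`.
      2 ^ (r * k)      <⟨ ℕ.m<m*n (2 ^ (r * k)) 2 {{ℕ.m^n≢0 2 (r * k)}} ℕ.≤-refl ⟩
      2 ^ (r * k) * 2  ≡⟨ cong (_* 2) (sym (ℕ.^-*-assoc 2 r k)) ⟩
      (2 ^ r) ^ k * 2  ≤⟨ ℕ.*-monoˡ-≤ 2 (ℕ.^-monoˡ-≤ k 2^r≤m) ⟩
      m ^ k * 2 ∎)
    where
    open ℕ.≤-Reasoning
    r = n ∸ t
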